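{- Let $l\ge 3$ be an integer, and let $n$ and $N$ be positive integers. Suppose that each of the numbers $1,2,\ldots,N$ has one of $n$ colours assigned to it, and that there are no monochromatic solutions to the equation $$x_1+x_2+\cdots+x_l=y.$$ Then $N\le e\,(n\lceil\log_2 l\rceil)!$.
   Context: A monochromatic solution of an equation, with respect to a colouring of $\{1,\ldots,N\}$, is an assignment of values in $\{1,\ldots,N\}$, all of the same colour, to the variables such that the equation holds; the values of the variables need not be distinct. Here $e$ is the base of the natural logarithm. -}

module Defs where

open import Data.Fin.Base using (Fin; toℕ)
open import Data.Integer.Base as ℤ using (+_)
import Data.Integer.Properties as ℤ
open import Data.Nat.Base as ℕ using (ℕ; zero; suc; _!)
import Data.Nat.Properties as ℕ
open import Data.Nat.Properties using (_!≢0)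
open import Data.Nat.Solver using () renaming (module +-*-Solver to ℕ-Solver)
open import Data.Product.Base using (_×_; _,_; ∃-syntax; Σ-syntax)
open import Data.Rational.Base as ℚ
  using (ℚ; mkℚ; 0ℚ; 1ℚ; _+_; _-_; -_; _*_; _/_; 1/_; ∣_∣; _≤_; _<_)
import Data.Rational.Properties as ℚ
open import Data.Rational.Solver using (module +-*-Solver)
import Data.Rational.Unnormalised.Base as ℚᵘ
import Data.Rational.Unnormalised.Properties as ℚᵘ
open import Data.Sum.Base using (inj₁; inj₂)
open import Data.Vec.Base using (Vec; map; sum)
open import Data.Vec.Relation.Unary.All using (All)
open import Relation.Binary.PropositionalEquality
  using (_≡_; refl; sym; trans; cong; cong₂; subst; subst₂)

Colouring : ℕ → ℕ → Set
Colouring N n = Fin N → Fin n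

-- The index i : Fin N stands for the number i + 1, so that Fin N
-- represents {1, …, N}.
value : ∀ {N} → Fin N → ℕ
value i = suc (toℕ i)

MonochromaticSolution : ∀ {N n} → ℕ → Colouring N n → Set
MonochromaticSolution {N} l c =
  Σ[ xs ∈ Vec (Fin N) l ] Σ[ y ∈ Fin N ]
    All (λ x → c x ≡ c y) xs × sum (map value xs) ≡ value y

IsCauchy : (ℕ → ℚ) → Set
IsCauchy s = ∀ ε → 0ℚ < ε →
  ∃[ K ] ∀ m n → K ℕ.≤ m → K ℕ.≤ n → ∣ s m - s n ∣ < ε

record ℝ : Set where
  constructor mkℝ
  field
    seq      : ℕ → ℚ
    isCauchy : IsCauchy seq

open ℝ public

infix 4 _≤ℝ_

-- A real is a Cauchy sequence, not an equivalence class of them, so _≡_ on ℝ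
-- is too fine; equal reals are those with x ≤ℝ y and y ≤ℝ x.
_≤ℝ_ : ℝ → ℝ → Set
x ≤ℝ y = ∀ ε → 0ℚ < ε → ∃[ K ] ∀ k → K ℕ.≤ k → seq x k ≤ seq y k + ε

fromℚ : ℚ → ℝ
fromℚ q = mkℝ (λ _ → q) λ ε 0<ε →
  0 , λ _ _ _ _ → subst (_< ε) (sym (cong ∣_∣ (ℚ.+-inverseʳ q))) 0<ε

fromℕ : ℕ → ℝ
fromℕ n = fromℚ (+ n / 1)

private
  eventuallyBounded : ∀ x →
    ∃[ B ] (0ℚ < B) × (∃[ K ] ∀ k → K ℕ.≤ k → ∣ seq x k ∣ < B)
  eventuallyBounded x with isCauchy x 1ℚ (ℚ.positive⁻¹ 1ℚ)
  ... | K , close = 1ℚ + ∣ a ∣ , 0<B , K , bound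
    where
    a = seq x K
    0<B : 0ℚ < 1ℚ + ∣ a ∣
    0<B = ℚ.+-mono-<-≤ (ℚ.positive⁻¹ 1ℚ) (ℚ.0≤∣p∣ a)
    bound : ∀ k → K ℕ.≤ k → ∣ seq x k ∣ < 1ℚ + ∣ a ∣
    bound k K≤k = begin-strict
      ∣ b ∣             ≡⟨ cong ∣_∣ (solve 2 (λ p q → p := (p :- q) :+ q) refl b a) ⟩
      ∣ b - a + a ∣     ≤⟨ ℚ.∣p+q∣≤∣p∣+∣q∣ (b - a) a ⟩
      ∣ b - a ∣ + ∣ a ∣ <⟨ ℚ.+-monoˡ-< ∣ a ∣ (close k K K≤k ℕ.≤-refl) ⟩
      1ℚ + ∣ a ∣        ∎
      where
      open ℚ.≤-Reasoning
      open +-*-Solver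
      b = seq x k

  product-difference : ∀ a b a′ b′ → a * b - a′ * b′ ≡ a * (b - b′) + (a - a′) * b′
  product-difference = solve 4 (λ a b a′ b′ →
    a :* b :- a′ :* b′ := a :* (b :- b′) :+ (a :- a′) :* b′) refl
    where open +-*-Solver

  product-close : ∀ B C δ a b a′ b′ → 0ℚ < B → 0ℚ < C → ∣ a ∣ < B → ∣ b′ ∣ < C →
    ∣ a - a′ ∣ < δ → ∣ b - b′ ∣ < δ → ∣ a * b - a′ * b′ ∣ < (B + C) * δ
  product-close B C δ a b a′ b′ 0<B 0<C a<B b′<C da<δ db<δ = begin-strict
    ∣ a * b - a′ * b′ ∣
      ≡⟨ cong ∣_∣ (product-difference a b a′ b′) ⟩
    ∣ a * (b - b′) + (a - a′) * b′ ∣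
      ≤⟨ ℚ.∣p+q∣≤∣p∣+∣q∣ (a * (b - b′)) ((a - a′) * b′) ⟩
    ∣ a * (b - b′) ∣ + ∣ (a - a′) * b′ ∣
      ≡⟨ cong₂ _+_ (ℚ.∣p*q∣≡∣p∣*∣q∣ a (b - b′))
                   (trans (ℚ.∣p*q∣≡∣p∣*∣q∣ (a - a′) b′) (ℚ.*-comm ∣ a - a′ ∣ ∣ b′ ∣)) ⟩
    ∣ a ∣ * ∣ b - b′ ∣ + ∣ b′ ∣ * ∣ a - a′ ∣
      ≤⟨ ℚ.+-mono-≤
           (ℚ.*-monoʳ-≤-nonNeg ∣ b - b′ ∣ {{ℚ.∣-∣-nonNeg (b - b′)}} (ℚ.<⇒≤ a<B))
           (ℚ.*-monoʳ-≤-nonNeg ∣ a - a′ ∣ {{ℚ.∣-∣-nonNeg (a - a′)}} (ℚ.<⇒≤ b′<C)) ⟩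
    B * ∣ b - b′ ∣ + C * ∣ a - a′ ∣
      <⟨ ℚ.+-mono-<
           (ℚ.*-monoʳ-<-pos B {{ℚ.positive 0<B}} db<δ)
           (ℚ.*-monoʳ-<-pos C {{ℚ.positive 0<C}} da<δ) ⟩
    B * δ + C * δ
      ≡⟨ ℚ.*-distribʳ-+ δ B C ⟨
    (B + C) * δ ∎
    where open ℚ.≤-Reasoning

  divide : ∀ D ε → 0ℚ < D → 0ℚ < ε → ∃[ δ ] 0ℚ < δ × D * δ ≡ ε
  divide D ε 0<D 0<ε = 1/ D * ε , ℚ.positive⁻¹ _ {{ℚ.pos*pos⇒pos (1/ D) ε}} ,
    trans (sym (ℚ.*-assoc D (1/ D) ε))
      (trans (cong (_* ε) (ℚ.*-inverseʳ D)) (ℚ.*-identityˡ ε))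
    where
    instance
      D>0 = ℚ.positive 0<D
      ε>0 = ℚ.positive 0<ε
      D≢0 = ℚ.pos⇒nonZero D
      1/D>0 = ℚ.1/pos⇒pos D

  EventuallyBelow : (ℕ → ℚ) → ℚ → Set
  EventuallyBelow s B = ∃[ K ] ∀ k → K ℕ.≤ k → ∣ s k ∣ < B

  EventuallyWithin : (ℕ → ℚ) → ℚ → Set
  EventuallyWithin s δ = ∃[ K ] ∀ m n → K ℕ.≤ m → K ℕ.≤ n → ∣ s m - s n ∣ < δ

  *-within : ∀ s t B C δ ε → 0ℚ < B → 0ℚ < C → (B + C) * δ ≡ ε →
    EventuallyBelow s B → EventuallyBelow t C →
    EventuallyWithin s δ → EventuallyWithin t δ → EventuallyWithin (λ k → s k * t k) ε
  *-within s t B C δ ε 0<B 0<C Dδ≡ε (K₁ , boundˢ) (K₂ , boundᵗ) (K₃ , closeˢ) (K₄ , closeᵗ) =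
    K , close
    where
    K = (K₁ ℕ.⊔ K₂) ℕ.⊔ (K₃ ℕ.⊔ K₄)
    K₁₂≤K = ℕ.m≤m⊔n (K₁ ℕ.⊔ K₂) (K₃ ℕ.⊔ K₄)
    K₃₄≤K = ℕ.m≤n⊔m (K₁ ℕ.⊔ K₂) (K₃ ℕ.⊔ K₄)
    K₁≤K = ℕ.≤-trans (ℕ.m≤m⊔n K₁ K₂) K₁₂≤K
    K₂≤K = ℕ.≤-trans (ℕ.m≤n⊔m K₁ K₂) K₁₂≤K
    K₃≤K = ℕ.≤-trans (ℕ.m≤m⊔n K₃ K₄) K₃₄≤K
    K₄≤K = ℕ.≤-trans (ℕ.m≤n⊔m K₃ K₄) K₃₄≤K
    close : ∀ m n → K ℕ.≤ m → K ℕ.≤ n →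
            ∣ s m * t m - s n * t n ∣ < ε
    close m n K≤m K≤n = subst (∣ s m * t m - s n * t n ∣ <_) Dδ≡ε
      (product-close B C δ (s m) (t m) (s n) (t n) 0<B 0<C
        (boundˢ m (ℕ.≤-trans K₁≤K K≤m))
        (boundᵗ n (ℕ.≤-trans K₂≤K K≤n))
        (closeˢ m n (ℕ.≤-trans K₃≤K K≤m) (ℕ.≤-trans K₃≤K K≤n))
        (closeᵗ m n (ℕ.≤-trans K₄≤K K≤m) (ℕ.≤-trans K₄≤K K≤n)))

  *-isCauchy : ∀ x y → IsCauchy (λ k → seq x k * seq y k)
  *-isCauchy x y ε 0<ε =
    let B , 0<B , below-B = eventuallyBounded x
        C , 0<C , below-C = eventuallyBounded y
        δ , 0<δ , Dδ≡ε = divide (B + C) ε (ℚ.+-mono-< 0<B 0<C) 0<ε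
    in *-within (seq x) (seq y) B C δ ε 0<B 0<C Dδ≡ε below-B below-C
         (isCauchy x δ 0<δ) (isCauchy y δ 0<δ)

infixl 7 _*ℝ_

_*ℝ_ : ℝ → ℝ → ℝ
x *ℝ y = mkℝ (λ k → seq x k * seq y k) (*-isCauchy x y)

1/!_ : ℕ → ℚ
1/! k = (+ 1 / k !) {{k !≢0}}

expSum : ℕ → ℚ
expSum zero    = 1/! 0
expSum (suc k) = expSum k + 1/! (suc k)

private
  1/suc : ℕ → ℚ
  1/suc n = + 1 / suc n

  0≤1/! : ∀ k → 0ℚ ≤ 1/! k
  0≤1/! k = ℚ.<⇒≤ (ℚ.positive⁻¹ (1/! k) {{ℚ.normalize-pos 1 (k !) {{k !≢0}}}})

  fraction : ∀ d .{{_ : ℕ.NonZero d}} → ℚ.toℚᵘ (+ 1 / d) ℚᵘ.≃ (+ 1 ℚᵘ./ d)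
  fraction (suc d) = ℚ.toℚᵘ-fromℚᵘ (ℚᵘ.mkℚᵘ (+ 1) d)

  1/-antimono : ∀ {c d} .{{_ : ℕ.NonZero c}} .{{_ : ℕ.NonZero d}} →
                c ℕ.≤ d → + 1 / d ≤ + 1 / c
  1/-antimono {suc c} {suc d} c≤d = ℚ.toℚᵘ-cancel-≤
    (ℚᵘ.≤-respˡ-≃ (ℚᵘ.≃-sym (fraction (suc d)))
      (ℚᵘ.≤-respʳ-≃ (ℚᵘ.≃-sym (fraction (suc c)))
        (ℚᵘ.*≤* (subst₂ ℤ._≤_ (sym (ℤ.*-identityˡ _)) (sym (ℤ.*-identityˡ _))
          (ℤ.+≤+ c≤d)))))

  telescope : ∀ n → + 1 / (suc (suc n) ℕ.* suc n) + 1/suc (suc n) ≡ 1/suc n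
  telescope n = ℚ.toℚᵘ-injective (begin
    ℚ.toℚᵘ (+ 1 / (suc (suc n) ℕ.* suc n) + 1/suc (suc n))
      ≈⟨ ℚ.toℚᵘ-homo-+ (+ 1 / (suc (suc n) ℕ.* suc n)) (1/suc (suc n)) ⟩
    ℚ.toℚᵘ (+ 1 / (suc (suc n) ℕ.* suc n)) ℚᵘ.+ ℚ.toℚᵘ (1/suc (suc n))
      ≈⟨ ℚᵘ.+-cong (fraction (suc (suc n) ℕ.* suc n)) (fraction (suc (suc n))) ⟩
    (+ 1 ℚᵘ./ (suc (suc n) ℕ.* suc n)) ℚᵘ.+ (+ 1 ℚᵘ./ suc (suc n))
      ≈⟨ ℚᵘ.*≡* (cong +_ (eq n)) ⟩
    + 1 ℚᵘ./ suc n
      ≈⟨ fraction (suc n) ⟨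
    ℚ.toℚᵘ (1/suc n) ∎)
    where
    open ℚᵘ.≃-Reasoning
    open ℕ-Solver
    eq : ∀ n → (1 ℕ.* suc (suc n) ℕ.+ 1 ℕ.* (suc (suc n) ℕ.* suc n)) ℕ.* suc n
             ≡ 1 ℕ.* ((suc (suc n) ℕ.* suc n) ℕ.* suc (suc n))
    eq = solve 1 (λ n →
      (con 1 :* (con 2 :+ n) :+ con 1 :* ((con 2 :+ n) :* (con 1 :+ n))) :* (con 1 :+ n)
      := con 1 :* (((con 2 :+ n) :* (con 1 :+ n)) :* (con 2 :+ n))) refl

  1/!-step : ∀ n → 1/! (suc (suc n)) + 1/suc (suc n) ≤ 1/suc n
  1/!-step n = subst (1/! (suc (suc n)) + 1/suc (suc n) ≤_) (telescope n)
    (ℚ.+-monoˡ-≤ (1/suc (suc n))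
      (1/-antimono {{_}} {{suc (suc n) !≢0}}
        (ℕ.*-monoʳ-≤ (suc (suc n)) (ℕ.m≤m*n (suc n) (n !) {{n !≢0}}))))

  expSum-≤ : ∀ d n → expSum n ≤ expSum (d ℕ.+ n)
  expSum-≤ zero    n = ℚ.≤-refl
  expSum-≤ (suc d) n = ℚ.≤-trans (expSum-≤ d n)
    (subst (_≤ expSum (suc d ℕ.+ n)) (ℚ.+-identityʳ _)
      (ℚ.+-monoʳ-≤ (expSum (d ℕ.+ n)) (0≤1/! (suc d ℕ.+ n))))

  expSum-tail : ∀ d n →
    expSum (d ℕ.+ suc n) + 1/suc (d ℕ.+ n) ≤ expSum (suc n) + 1/suc n
  expSum-tail zero    n = ℚ.≤-refl
  expSum-tail (suc d) n = ℚ.≤-trans step (expSum-tail d n)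
    where
    step : expSum (suc d ℕ.+ suc n) + 1/suc (suc d ℕ.+ n)
           ≤ expSum (d ℕ.+ suc n) + 1/suc (d ℕ.+ n)
    step rewrite ℕ.+-suc d n = subst
      (_≤ expSum (suc (d ℕ.+ n)) + 1/suc (d ℕ.+ n))
      (sym (ℚ.+-assoc (expSum (suc (d ℕ.+ n))) (1/! (suc (suc (d ℕ.+ n)))) _))
      (ℚ.+-monoʳ-≤ (expSum (suc (d ℕ.+ n))) (1/!-step (d ℕ.+ n)))

  archimedean : ∀ ε → 0ℚ < ε → ∃[ K ] 1/suc K < ε
  archimedean ε@(mkℚ ℤ.-[1+ _ ] _ _) 0<ε with () ← ℚ.positive {ε} 0<ε
  archimedean ε@(mkℚ ℤ.+0       _ _) 0<ε with () ← ℚ.positive {ε} 0<ε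
  archimedean (mkℚ ℤ.+[1+ p′ ] q _) _ = suc q , ℚ.toℚᵘ-cancel-<
    (ℚᵘ.<-respˡ-≃ (ℚᵘ.≃-sym (fraction (suc (suc q))))
      (ℚᵘ.*<* (ℤ.+<+ (begin-strict
        1 ℕ.* suc q                ≡⟨ ℕ.*-identityˡ (suc q) ⟩
        suc q                      <⟨ ℕ.n<1+n (suc q) ⟩
        suc (suc q)                ≤⟨ ℕ.m≤n*m (suc (suc q)) (suc p′) ⟩
        suc p′ ℕ.* suc (suc q)     ∎))))
    where open ℕ.≤-Reasoning

  expSum-close-≤ : ∀ K m n → suc K ℕ.≤ n → n ℕ.≤ m → ∣ expSum m - expSum n ∣ ≤ 1/suc K
  expSum-close-≤ K m (suc n) (ℕ.s≤s K≤n) n≤m with m ℕ.∸ suc n | ℕ.m∸n+n≡m n≤m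
  ... | d | refl = begin
    ∣ expSum (d ℕ.+ suc n) - expSum (suc n) ∣
      ≡⟨ ℚ.0≤p⇒∣p∣≡p (subst (_≤ expSum (d ℕ.+ suc n) - expSum (suc n))
           (ℚ.+-inverseʳ (expSum (suc n)))
           (ℚ.+-monoˡ-≤ (- expSum (suc n)) (expSum-≤ d (suc n)))) ⟩
    expSum (d ℕ.+ suc n) - expSum (suc n)
      ≤⟨ ℚ.+-monoˡ-≤ (- expSum (suc n)) upper ⟩
    expSum (suc n) + 1/suc n - expSum (suc n)
      ≡⟨ solve 2 (λ a b → a :+ b :- a := b) refl (expSum (suc n)) (1/suc n) ⟩
    1/suc n
      ≤⟨ 1/-antimono (ℕ.s≤s K≤n) ⟩
    1/suc K ∎
    where
    open ℚ.≤-Reasoning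
    open +-*-Solver
    upper : expSum (d ℕ.+ suc n) ≤ expSum (suc n) + 1/suc n
    upper = ℚ.≤-trans
      (subst (_≤ expSum (d ℕ.+ suc n) + 1/suc (d ℕ.+ n)) (ℚ.+-identityʳ _)
        (ℚ.+-monoʳ-≤ (expSum (d ℕ.+ suc n))
          (ℚ.<⇒≤ (ℚ.positive⁻¹ _ {{ℚ.normalize-pos 1 (suc (d ℕ.+ n))}}))))
      (expSum-tail d n)

  expSum-close : ∀ K m n → suc K ℕ.≤ m → suc K ℕ.≤ n → ∣ expSum m - expSum n ∣ ≤ 1/suc K
  expSum-close K m n K<m K<n with ℕ.≤-total n m
  ... | inj₁ n≤m = expSum-close-≤ K m n K<n n≤m
  ... | inj₂ m≤n = subst (_≤ 1/suc K)
    (trans (sym (ℚ.∣-p∣≡∣p∣ (expSum n - expSum m)))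
      (cong ∣_∣ (solve 2 (λ a b → :- (a :- b) := b :- a) refl (expSum n) (expSum m))))
    (expSum-close-≤ K n m K<m m≤n)
    where open +-*-Solver

  expSum-isCauchy : IsCauchy expSum
  expSum-isCauchy ε 0<ε with archimedean ε 0<ε
  ... | K , 1/K<ε = suc K , λ m n K<m K<n →
    ℚ.≤-<-trans (expSum-close K m n K<m K<n) 1/K<ε

-- e = Σₖ 1/k!, the sequence being the partial sums.
e : ℝ
e = mkℝ expSum expSum-isCauchy

-- A set A of positive integers with no solution of x₁ + ⋯ + xₗ = y splits
-- into A ∖ 2A, which is sum-free, and A ∩ 2A, which has no solution of
-- x₁ + ⋯ + xₕ = y for h = ⌈l/2⌉: writing ⌊l/2⌋ of the h summands as sums of two
-- elements of A would give a sum of l elements of A.  After k = ⌈log₂ l⌉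
-- halvings nothing is left, so each colour class is a union of k sum-free
-- sets and {1, …, N} is covered by m = nk of them.  Colouring the edge uv
-- (u < v) of the complete graph on {0, …, N} by a sum-free set containing
-- v − u leaves no monochromatic triangle, and the classical bound for the
-- triangle Ramsey number gives N + 1 ≤ m! (1/0! + 1/1! + ⋯ + 1/m!).
module Submission where

open import Defs
open import Data.Nat using (ℕ; _≤_; _*_; _!; NonZero)
open import Data.Nat.Logarithm using (⌈log₂_⌉)
open import Relation.Nullary using (¬_)

open import Data.Fin.Base using (Fin; zero; suc; toℕ; punchIn; punchOut; combine; remQuot; fromℕ<)
open import Data.Fin.Properties
  using (any?; punchIn-punchOut; remQuot-combine; toℕ-fromℕ<) renaming (_≟_ to _≟ᶠ_)
open import Data.Integer.Base as ℤ using (+_; +≤+)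
import Data.Integer.Properties as ℤ
open import Data.List.Base using (List; []; _∷_; length; upTo)
open import Data.List.Properties using (length-upTo)
open import Data.List.Relation.Binary.Sublist.Propositional using (_⊆_; []; _∷_; _∷ʳ_; ⊆-trans)
open import Data.List.Relation.Binary.Sublist.Propositional.Properties using (All-resp-⊆)
open import Data.List.Relation.Unary.All as All using (All; []; _∷_)
open import Data.List.Relation.Unary.AllPairs using (AllPairs; []; _∷_)
import Data.List.Relation.Unary.AllPairs.Properties as AllPairs
open import Data.Nat.Base
  using (zero; suc; _≤′_; ≤′-refl; ≤′-step; _+_; _∸_; _<_; z≤n; s≤s; ⌊_/2⌋; ⌈_/2⌉)
open import Data.Nat.Logarithm using (⌈log₂⌉-mono-≤; ⌈log₂⌈n/2⌉⌉≡⌈log₂n⌉∸1)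
import Data.Nat.Properties as ℕ
open import Data.Product.Base using (_×_; _,_; proj₁; proj₂; ∃-syntax; Σ-syntax)
open import Data.Rational.Base as ℚ using (ℚ; 0ℚ; 1ℚ; _/_)
import Data.Rational.Properties as ℚ
open import Data.Rational.Solver using (module +-*-Solver)
import Data.Rational.Unnormalised.Base as ℚᵘ
import Data.Rational.Unnormalised.Properties as ℚᵘ
open import Data.Sum.Base using (_⊎_; inj₁; inj₂)
open import Data.Vec.Base as Vec using (Vec; []; _∷_)
import Data.Vec.Relation.Unary.All as VecAll
open import Relation.Binary.Core using (Rel)
open import Relation.Binary.PropositionalEquality
open import Relation.Nullary using (yes; no; contradiction)
open import Relation.Nullary.Decidable using (_×-dec_)
open import Relation.Unary using (Pred; Decidable; _∪_; _∩_)
open import Level using (0ℓ)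

-- The triangle Ramsey number

-- The recursion counts one vertex and its `suc m` monochromatic neighbourhoods; `triangleBound≡`
-- identifies the value at `m` as m! (1/0! + ⋯ + 1/m!).
triangleBound : ℕ → ℕ
triangleBound zero    = 1
triangleBound (suc m) = 1 + suc m * triangleBound m

module _ {X : Set} where

  AllPairs-resp-⊆ : ∀ {R : Rel X 0ℓ} {xs ys : List X} → xs ⊆ ys → AllPairs R ys → AllPairs R xs
  AllPairs-resp-⊆ []         []       = []
  AllPairs-resp-⊆ (_ ∷ʳ s)   (_ ∷ rs) = AllPairs-resp-⊆ s rs
  AllPairs-resp-⊆ (refl ∷ s) (r ∷ rs) = All-resp-⊆ s r ∷ AllPairs-resp-⊆ s rs

  -- `ys` and `zs` keep the order of `xs`, so that a pairwise relation on `xs` restricts to them by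
  -- `AllPairs-resp-⊆`.
  split-∪ : ∀ {P Q : Pred X 0ℓ} {xs} → All (P ∪ Q) xs →
    ∃[ ys ] ∃[ zs ] (ys ⊆ xs × All P ys) × (zs ⊆ xs × All Q zs) ×
      length xs ≡ length ys + length zs
  split-∪ [] = [] , [] , ([] , []) , ([] , []) , refl
  split-∪ {xs = x ∷ _} (inj₁ p ∷ ps) with split-∪ ps
  ... | ys , zs , (s , pys) , (t , qzs) , eq =
    x ∷ ys , zs , (refl ∷ s , p ∷ pys) , (x ∷ʳ t , qzs) , cong suc eq
  split-∪ {xs = x ∷ _} (inj₂ q ∷ ps) with split-∪ ps
  ... | ys , zs , (s , pys) , (t , qzs) , eq =
    ys , x ∷ zs , (x ∷ʳ s , pys) , (refl ∷ t , q ∷ qzs) ,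
    trans (cong suc eq) (sym (ℕ.+-suc (length ys) (length zs)))

  -- Pigeonhole: each element is counted in one set that contains it, which sorts `xs` into `m`
  -- sublists of length at most `b`.
  length-cover-≤ : ∀ m (P : Fin m → Pred X 0ℓ) b xs → All (λ x → ∃[ i ] P i x) xs →
    (∀ i ys → ys ⊆ xs → All (P i) ys → length ys ≤ b) → length xs ≤ m * b
  length-cover-≤ zero    P b []      _              _ = z≤n
  length-cover-≤ zero    P b (_ ∷ _) ((() , _) ∷ _) _
  length-cover-≤ (suc m) P b xs cover bound
    with split-∪ {P = P zero} {Q = λ x → ∃[ i ] P (suc i) x} (All.map first? cover)
    where
    first? : ∀ {x} → ∃[ i ] P i x → P zero x ⊎ ∃[ i ] P (suc i) x
    first? (zero  , p) = inj₁ p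
    first? (suc i , p) = inj₂ (i , p)
  ... | ys , zs , (s , pys) , (t , qzs) , eq = begin
    length xs             ≡⟨ eq ⟩
    length ys + length zs ≤⟨ ℕ.+-mono-≤ (bound zero ys s pys)
                               (length-cover-≤ m (λ i → P (suc i)) b zs qzs
                                 λ i ws w pws → bound (suc i) ws (⊆-trans w t) pws) ⟩
    b + m * b             ∎
    where open ℕ.≤-Reasoning

  TriangleFree : Rel X 0ℓ → Set
  TriangleFree E = ∀ {u v w} → E u v → E v w → ¬ E u w

  -- The later vertices are sorted by the colour of their edge to the first vertex `v`. Each of the
  -- `suc m` neighbourhoods uses only `m` colours inside, so induction bounds it.
  triangle-ramsey : ∀ m (E : Fin m → Rel X 0ℓ) → (∀ i → TriangleFree (E i)) →
    ∀ vs → AllPairs (λ u v → ∃[ i ] E i u v) vs → length vs ≤ triangleBound m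
  triangle-ramsey zero    E free []          _                    = z≤n
  triangle-ramsey zero    E free (_ ∷ [])    _                    = s≤s z≤n
  triangle-ramsey zero    E free (_ ∷ _ ∷ _) (((() , _) ∷ _) ∷ _)
  triangle-ramsey (suc m) E free []          _                    = z≤n
  triangle-ramsey (suc m) E free (v ∷ vs)    (from-v ∷ pairs)     =
    s≤s (length-cover-≤ (suc m) (λ i → E i v) (triangleBound m) vs from-v neighbours)
    where
    -- An edge of colour `i` inside this neighbourhood would close a triangle with `v`; `punchIn i`
    -- renumbers the remaining colours.
    avoid : ∀ i {xs} → All (E i v) xs → AllPairs (λ x y → ∃[ j ] E j x y) xs →
      AllPairs (λ x y → ∃[ j ] E (punchIn i j) x y) xs
    avoid i []         []         = []
    avoid i (vx ∷ vxs) (xys ∷ ps) = All.zipWith edge (vxs , xys) ∷ avoid i vxs ps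
      where
      edge : ∀ {y} → E i v y × (∃[ j ] E j _ y) → ∃[ j ] E (punchIn i j) _ y
      edge (vy , j , xy) = punchOut i≢j , subst (λ j → E j _ _) (sym (punchIn-punchOut i≢j)) xy
        where
        i≢j : i ≢ j
        i≢j refl = free i vx xy vy

    neighbours : ∀ i xs → xs ⊆ vs → All (E i v) xs → length xs ≤ triangleBound m
    neighbours i xs s vxs = triangle-ramsey m (λ j → E (punchIn i j)) (λ j → free (punchIn i j))
      xs (avoid i vxs (AllPairs-resp-⊆ s pairs))

-- Splitting into sum-free sets

data Sums (A : Pred ℕ 0ℓ) : ℕ → ℕ → Set where
  []  : Sums A 0 0
  _∷_ : ∀ {x m s} → A x → Sums A m s → Sums A (suc m) (x + s)

SumFree : Pred ℕ 0ℓ → Set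
SumFree A = ∀ {x y} → A x → A y → ¬ A (x + y)

-- The sumset A + A. The second summand is written `z ∸ x` and `x` is bounded, so that membership is
-- a finite search.
Double : Pred ℕ 0ℓ → Pred ℕ 0ℓ
Double A z = ∃[ x ] x < suc z × A x × A (z ∸ x) × x + (z ∸ x) ≡ z

double? : ∀ {A} → Decidable A → Decidable (Double A)
double? A? z = ℕ.anyUpTo? (λ x → A? x ×-dec A? (z ∸ x) ×-dec (x + (z ∸ x) ℕ.≟ z)) (suc z)

double-+ : ∀ {A x y} → A x → A y → Double A (x + y)
double-+ {A} {x} {y} ax ay =
  x , s≤s (ℕ.m≤m+n x y) , ax , subst A (sym eq) ay , cong (_+_ x) eq
  where
  eq : x + y ∸ x ≡ y
  eq = ℕ.m+n∸m≡n x y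

-- Each of the first `q` summands is replaced by two elements of `A` with the same sum, which adds
-- `q` to the count; the others stay, as elements of `A`.
expand : ∀ {A h s} → Sums (A ∩ Double A) h s → ∀ q → q ≤ h → Sums A (q + h) s
expand []             zero    _         = []
expand ((a , _) ∷ ss) zero    _         = a ∷ expand ss zero z≤n
expand {A} (_∷_ {x} {h} {s} (_ , y , _ , ay , az , eq) ss) (suc q) (s≤s q≤h) =
  subst₂ (Sums A) (cong suc (sym (ℕ.+-suc q h)))
    (trans (sym (ℕ.+-assoc y (x ∸ y) s)) (cong (_+ s) eq))
    (ay ∷ az ∷ expand ss q q≤h)

split-sumFree : ∀ k l A → Decidable A → 1 ≤ l → ⌈log₂ l ⌉ ≡ k →
  (∀ {y} → A y → ¬ Sums A l y) →
  Σ[ K ∈ (Fin k → Pred ℕ 0ℓ) ] (∀ j → SumFree (K j)) × (∀ {d} → A d → ∃[ j ] K j d)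
-- Here `l` is 1, and an element of `A` is itself a sum of one element of `A`, so `A` is empty.
split-sumFree zero (suc zero) A A? _ _ noSums =
  (λ ()) , (λ ()) , λ {d} a →
    contradiction (subst (Sums A 1) (ℕ.+-identityʳ d) (a ∷ [])) (noSums a)
split-sumFree zero (suc (suc l)) A A? _ log≡0 noSums =
  contradiction (subst (1 ≤_) log≡0 (⌈log₂⌉-mono-≤ {2} {suc (suc l)} (s≤s (s≤s z≤n)))) λ ()
split-sumFree (suc k) l A A? 1≤l log≡ noSums
  with split-sumFree k ⌈ l /2⌉ (A ∩ Double A) (λ x → A? x ×-dec double? A? x)
         (ℕ.⌈n/2⌉-mono 1≤l)
         (trans (⌈log₂⌈n/2⌉⌉≡⌈log₂n⌉∸1 l) (cong (_∸ 1) log≡))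
         -- ⌊l/2⌋ of the ⌈l/2⌉ summands are doubled, so the expanded sum has exactly `l` terms.
         (λ (a , _) ss → noSums a (subst (λ m → Sums A m _) (ℕ.⌊n/2⌋+⌈n/2⌉≡n l)
           (expand ss ⌊ l /2⌋ (ℕ.⌊n/2⌋≤⌈n/2⌉ l))))
... | K , free , cover = K′ , free′ , cover′
  where
  K′ : Fin (suc k) → Pred ℕ 0ℓ
  K′ zero    d = A d × ¬ Double A d
  K′ (suc j)   = K j

  free′ : ∀ j → SumFree (K′ j)
  free′ zero    (ax , _) (ay , _) (_ , ¬double) = ¬double (double-+ ax ay)
  free′ (suc j) = free j

  cover′ : ∀ {d} → A d → ∃[ j ] K′ j d
  cover′ {d} a with double? A? d
  ... | no ¬double = zero , a , ¬double
  ... | yes double with cover (a , double)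
  ...   | j , kj = suc j , kj

-- Schur's bound

-- Since (v - u) + (w - v) = w - u, a triangle would be a solution of x + y = z in `K`.
difference-triangleFree : ∀ {K} → SumFree K → TriangleFree (λ u v → ∃[ d ] K d × u + d ≡ v)
difference-triangleFree {K} free {u} (d , kd , refl) (d′ , kd′ , refl) (d″ , kd″ , eq) =
  free kd kd′ (subst K (ℕ.+-cancelˡ-≡ u d″ (d + d′) (trans eq (ℕ.+-assoc u d d′))) kd″)

schur : ∀ m N (K : Fin m → Pred ℕ 0ℓ) → (∀ i → SumFree (K i)) →
  (∀ d → d < N → ∃[ i ] K i (suc d)) → suc N ≤ triangleBound m
schur m N K free cover = subst (_≤ triangleBound m) (length-upTo (suc N))
  (triangle-ramsey m (λ i u v → ∃[ d ] K i d × u + d ≡ v)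
    (λ i → difference-triangleFree (free i)) (upTo (suc N))
    (AllPairs.applyUpTo⁺₁ _ (suc N) edge))
  where
  edge : ∀ {u v} → u < v → v < suc N → ∃[ i ] ∃[ d ] K i d × u + d ≡ v
  -- `d` is v - u - 1, which fits `cover`, a statement about `suc d`.
  edge {u} {v} u<v (s≤s v≤N) with ℕ.m≤n⇒∃[o]m+o≡n u<v
  ... | d , refl with cover d (ℕ.≤-trans (s≤s (ℕ.m≤n+m d u)) v≤N)
  ...   | i , k = i , suc d , k , ℕ.+-suc u d

-- Colour classes and their sum-free parts

module _ {N n : ℕ} (c : Colouring N n) where

  -- A set of numbers rather than of indices, the form that `split-sumFree` takes; 0 and the numbers
  -- above `N` lie in no class.
  Class : Fin n → Pred ℕ 0ℓ
  Class i d = ∃[ x ] value {N} x ≡ d × c x ≡ i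

  class? : ∀ i → Decidable (Class i)
  class? i d = any? λ x → (value x ℕ.≟ d) ×-dec (c x ≟ᶠ i)

  Sums⇒Vec : ∀ {i l s} → Sums (Class i) l s →
    Σ[ xs ∈ Vec (Fin N) l ] VecAll.All (λ x → c x ≡ i) xs × Vec.sum (Vec.map value xs) ≡ s
  Sums⇒Vec [] = [] , VecAll.[] , refl
  Sums⇒Vec ((x , refl , cx) ∷ ss) with Sums⇒Vec ss
  ... | xs , cxs , refl = x ∷ xs , cx VecAll.∷ cxs , refl

  class-noSums : ∀ {l} → ¬ MonochromaticSolution l c → ∀ i {y} → Class i y → ¬ Sums (Class i) l y
  class-noSums none i (y , refl , refl) ss with Sums⇒Vec ss
  ... | xs , cxs , eq = none (xs , y , cxs , eq)

  colouring-bound : ∀ l → 1 ≤ l → ¬ MonochromaticSolution l c →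
    suc N ≤ triangleBound (n * ⌈log₂ l ⌉)
  colouring-bound l 1≤l none =
    -- `remQuot` reads an index below nk as a pair: a colour and one of the `k` parts of its class.
    schur (n * k) N (λ t → K (remQuot k t)) (λ t → free (remQuot k t)) cover
    where
    k = ⌈log₂ l ⌉
    parts : ∀ i → Σ[ K ∈ (Fin k → Pred ℕ 0ℓ) ]
      (∀ j → SumFree (K j)) × (∀ {d} → Class i d → ∃[ j ] K j d)
    parts i = split-sumFree k l (Class i) (class? i) 1≤l refl (class-noSums none i)

    K : Fin n × Fin k → Pred ℕ 0ℓ
    K (i , j) = proj₁ (parts i) j

    free : ∀ ij → SumFree (K ij)
    free (i , j) = proj₁ (proj₂ (parts i)) j

    cover : ∀ d → d < N → ∃[ t ] K (remQuot k t) (suc d)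
    cover d d<N with fromℕ< d<N in eq
    ... | x with proj₂ (proj₂ (parts (c x)))
                   (x , cong suc (trans (cong toℕ (sym eq)) (toℕ-fromℕ< d<N)) , refl)
    ...   | j , kj = combine (c x) j ,
      subst (λ ij → K ij (suc d)) (sym (remQuot-combine (c x) j)) kj

-- Comparison with e

ι : ℕ → ℚ
ι n = + n / 1

-- `_/_` on ℚ reduces fractions; after passing to unnormalised rationals, identities become
-- cross-multiplied integer equations.
toℚᵘ-/ : ∀ n d .{{_ : NonZero d}} → ℚ.toℚᵘ (+ n / d) ℚᵘ.≃ (+ n ℚᵘ./ d)
toℚᵘ-/ n (suc d) = ℚ.toℚᵘ-fromℚᵘ (ℚᵘ.mkℚᵘ (+ n) d)

ι-+ : ∀ m n → ι (m + n) ≡ ι m ℚ.+ ι n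
ι-+ m n = ℚ.toℚᵘ-injective (begin
  ℚ.toℚᵘ (ι (m + n))                ≈⟨ toℚᵘ-/ (m + n) 1 ⟩
  + (m + n) ℚᵘ./ 1                  ≈⟨ ℚᵘ.*≡* (cong (ℤ._* + 1) (sym (cong₂ ℤ._+_
                                         (ℤ.*-identityʳ (+ m)) (ℤ.*-identityʳ (+ n))))) ⟩
  (+ m ℚᵘ./ 1) ℚᵘ.+ (+ n ℚᵘ./ 1)    ≈⟨ ℚᵘ.+-cong (toℚᵘ-/ m 1) (toℚᵘ-/ n 1) ⟨
  ℚ.toℚᵘ (ι m) ℚᵘ.+ ℚ.toℚᵘ (ι n)    ≈⟨ ℚ.toℚᵘ-homo-+ (ι m) (ι n) ⟨
  ℚ.toℚᵘ (ι m ℚ.+ ι n)              ∎)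
  where open ℚᵘ.≃-Reasoning

ι-* : ∀ m n → ι (m * n) ≡ ι m ℚ.* ι n
ι-* m n = ℚ.toℚᵘ-injective (begin
  ℚ.toℚᵘ (ι (m * n))                ≈⟨ toℚᵘ-/ (m * n) 1 ⟩
  + (m * n) ℚᵘ./ 1                  ≈⟨ ℚᵘ.*≡* (cong (ℤ._* + 1) (ℤ.pos-* m n)) ⟩
  (+ m ℚᵘ./ 1) ℚᵘ.* (+ n ℚᵘ./ 1)    ≈⟨ ℚᵘ.*-cong (toℚᵘ-/ m 1) (toℚᵘ-/ n 1) ⟨
  ℚ.toℚᵘ (ι m) ℚᵘ.* ℚ.toℚᵘ (ι n)    ≈⟨ ℚ.toℚᵘ-homo-* (ι m) (ι n) ⟨
  ℚ.toℚᵘ (ι m ℚ.* ι n)              ∎)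
  where open ℚᵘ.≃-Reasoning

ι-mono-≤ : ∀ {m n} → m ≤ n → ι m ℚ.≤ ι n
ι-mono-≤ {m} {n} m≤n = ℚ.toℚᵘ-cancel-≤
  (ℚᵘ.≤-respˡ-≃ (ℚᵘ.≃-sym (toℚᵘ-/ m 1))
    (ℚᵘ.≤-respʳ-≃ (ℚᵘ.≃-sym (toℚᵘ-/ n 1))
      (ℚᵘ.*≤* (ℤ.*-monoʳ-≤-nonNeg (+ 1) (+≤+ m≤n)))))

1/d*d≡1 : ∀ d .{{_ : NonZero d}} → (+ 1 / d) ℚ.* ι d ≡ 1ℚ
1/d*d≡1 d@(suc d-1) = ℚ.toℚᵘ-injective (begin
  ℚ.toℚᵘ ((+ 1 / d) ℚ.* ι d)             ≈⟨ ℚ.toℚᵘ-homo-* (+ 1 / d) (ι d) ⟩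
  ℚ.toℚᵘ (+ 1 / d) ℚᵘ.* ℚ.toℚᵘ (ι d)     ≈⟨ ℚᵘ.*-cong (toℚᵘ-/ 1 d) (toℚᵘ-/ d 1) ⟩
  (+ 1 ℚᵘ./ d) ℚᵘ.* (+ d ℚᵘ./ 1)         ≈⟨ ℚᵘ.*≡* (cong +_ eq) ⟩
  ℚ.toℚᵘ 1ℚ                              ∎)
  where
  open ℚᵘ.≃-Reasoning
  eq : 1 * d * 1 ≡ 1 * (d * 1)
  eq = ℕ.*-assoc 1 d 1

-- When `expSum (suc m)` is multiplied by (m + 1)!, the old terms give m + 1 times the previous
-- value, and the new term 1/(m + 1)! gives the 1 of the recursion.
triangleBound≡ : ∀ m → ι (triangleBound m) ≡ expSum m ℚ.* ι (m !)
triangleBound≡ zero    = refl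
triangleBound≡ (suc m) = begin
  ι (1 + suc m * triangleBound m)
    ≡⟨ ι-+ 1 (suc m * triangleBound m) ⟩
  1ℚ ℚ.+ ι (suc m * triangleBound m)
    ≡⟨ cong (1ℚ ℚ.+_) (trans (ι-* (suc m) (triangleBound m))
         (cong (ι (suc m) ℚ.*_) (triangleBound≡ m))) ⟩
  1ℚ ℚ.+ ι (suc m) ℚ.* (expSum m ℚ.* ι (m !))
    ≡⟨ solve 4 (λ a b c d → a :+ b :* (c :* d) := c :* (b :* d) :+ a) refl
         1ℚ (ι (suc m)) (expSum m) (ι (m !)) ⟩
  expSum m ℚ.* (ι (suc m) ℚ.* ι (m !)) ℚ.+ 1ℚ
    ≡⟨ cong₂ ℚ._+_ (cong (expSum m ℚ.*_) (ι-* (suc m) (m !)))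
         (1/d*d≡1 (suc m !) {{suc m ℕ.!≢0}}) ⟨
  expSum m ℚ.* ι (suc m !) ℚ.+ 1/! suc m ℚ.* ι (suc m !)
    ≡⟨ ℚ.*-distribʳ-+ (ι (suc m !)) (expSum m) (1/! suc m) ⟨
  expSum (suc m) ℚ.* ι (suc m !) ∎
  where
  open ≡-Reasoning
  open +-*-Solver

p≤p+q : ∀ p q → 0ℚ ℚ.≤ q → p ℚ.≤ p ℚ.+ q
p≤p+q p q 0≤q = subst (ℚ._≤ p ℚ.+ q) (ℚ.+-identityʳ p) (ℚ.+-monoʳ-≤ p 0≤q)

expSum-mono-≤ : ∀ {m n} → m ≤ n → expSum m ℚ.≤ expSum n
expSum-mono-≤ m≤n = go (ℕ.≤⇒≤′ m≤n)
  where
  go : ∀ {m n} → m ≤′ n → expSum m ℚ.≤ expSum n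
  go ≤′-refl = ℚ.≤-refl
  go {m} {suc n} (≤′-step p) = ℚ.≤-trans (go p)
    (p≤p+q (expSum n) (1/! suc n)
      (ℚ.nonNegative⁻¹ (1/! suc n) {{ℚ.normalize-nonNeg 1 (suc n !) {{suc n ℕ.!≢0}}}}))

-- The right-hand sequence is `expSum k` times m!. Partial sums increase, so from k = m on it is at
-- least `triangleBound m`; thus m serves as the threshold for every ε.
fromℕ≤e* : ∀ {N} m → N ≤ triangleBound m → fromℕ N ≤ℝ e *ℝ fromℕ (m !)
fromℕ≤e* {N} m N≤ ε 0<ε = m , λ k m≤k → begin
  ι N                            ≤⟨ ι-mono-≤ N≤ ⟩
  ι (triangleBound m)        ≡⟨ triangleBound≡ m ⟩
  expSum m ℚ.* ι (m !)           ≤⟨ ℚ.*-monoʳ-≤-nonNeg (ι (m !)) {{ℚ.normalize-nonNeg (m !) 1}}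
                                      (expSum-mono-≤ m≤k) ⟩
  expSum k ℚ.* ι (m !)           ≤⟨ p≤p+q _ ε (ℚ.<⇒≤ 0<ε) ⟩
  expSum k ℚ.* ι (m !) ℚ.+ ε     ∎
  where open ℚ.≤-Reasoning

theorem6 : (l n N : ℕ) .{{_ : NonZero n}} .{{_ : NonZero N}} → 3 ≤ l →
    (c : Colouring N n) → ¬ MonochromaticSolution l c →
    fromℕ N ≤ℝ e *ℝ fromℕ ((n * ⌈log₂ l ⌉) !)
theorem6 l n N 3≤l c none = fromℕ≤e* (n * ⌈log₂ l ⌉)
  (ℕ.≤-trans (ℕ.n≤1+n N) (colouring-bound c l (ℕ.≤-trans (s≤s z≤n) 3≤l) none))
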